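{- Consider the sandpile dynamics in which each cell is allowed to topple at most once. Then both of the following hold. (a) There exist two neighborhoods $A,B$ such that some non-uniform $\{A,B\}$-grid admits a crossing gate, but for all integers $p,q\ge 1$, no uniform grid with neighborhood $A^pB^q$ admits a crossing gate. (b) There exist two neighborhoods $A,B$ such that some uniform grid with neighborhood $A^1B^1$ admits a crossing gate, but no non-uniform $\{A,B\}$-grid admits a crossing gate.
   Context: Grids. For $\ell,\ell'\ge 1$ let $V=\{1,\dots,\ell\}\times\{1,\dots,\ell'\}$ be the set of cells; the first coordinate increases to the East and the second coordinate increases to the North. The West, East, South and North edges of the grid are the sets of cells with first coordinate $1$, first coordinate $\ell$, second coordinate $1$, second coordinate $\ell'$, respectively; corners are cells lying on two edges of different axes. A neighborhood is a nonempty finite multiset $N$ of elements of $\mathbb{Z}^2\setminus\{(0,0)\}$; $N(\delta)$ denotes the multiplicity of $\delta$ and $|N|$ the total number of elements counted with multiplicity. For neighborhoods $A,B$ and $p,q\ge 1$, $A^pB^q$ denotes the neighborhood with multiplicities $\delta\mapsto pA(\delta)+qB(\delta)$. A grid is a set of cells $V=\{1,\dots,\ell\}\times\{1,\dots,\ell'\}$ for some $\ell,\ell'\ge 1$, together with a neighborhood $N_u$ for each cell $u\in V$. It is uniform with neighborhood $N$ if $N_u=N$ for all $u$. A non-uniform $\{A,B\}$-grid is a grid in which $N_u\in\{A,B\}$ for every $u\in V$, the choice being allowed to depend on $u$. In the claim, grids of all sizes $\ell,\ell'$ are considered. Dynamics (each cell topples at most once). A configuration is a function $c:V\to\mathbb{N}$;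 it is stable if $c(u)<|N_u|$ for all $u$. Starting from a configuration, at each parallel time step every cell $u$ that contains at least $|N_u|$ grains and that has not toppled at an earlier step topples: it loses $|N_u|$ grains and sends $N_u(\delta)$ grains to $u+\delta$ for each $\delta$; grains sent outside $V$ are lost. A cell topples (starting from a given configuration) if it topples at some step. Crossing gate. Let $X,X'$ be two opposite edges of the grid and $Y,Y'$ be the other two opposite edges (so $\{\{X,X'\},\{Y,Y'\}\}=\{\{\text{North},\text{South}\},\{\text{West},\text{East}\}\}$; any choice of directions is allowed). A stable configuration $c$ is a crossing gate if, for some such choice, there are a non-corner cell $x\in X$, a cell $x'\in X'$, a non-corner cell $y\in Y$ and a cell $y'\in Y'$ such that: starting from $c$ with one grain added at $x$, the cell $x'$ topples and no cell of $Y'$ topples; and starting from $c$ with one grain added at $y$, the cell $y'$ topples and no cell of $X'$ topples. A grid admits a crossing gate if some stable configuration on it is a crossing gate. -}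

module Defs where

open import Data.Bool using (Bool; true; false; T; not; _∧_; _∨_; if_then_else_)
open import Data.Empty using (⊥-elim)
open import Data.Fin using (Fin; toℕ)
import Data.Fin.Properties as Fin
open import Data.Integer using (ℤ; 0ℤ)
import Data.Integer as ℤ
import Data.Integer.Properties as ℤ
open import Data.List using (List; []; _∷_; _++_; length; filter; concat; replicate; map; allFin; cartesianProduct)
open import Data.List.Properties using (length-++; filter-++)
open import Data.List.Relation.Unary.All using (All)
import Data.List.Relation.Unary.All.Properties as All
open import Data.List.Relation.Binary.Permutation.Propositional using (_↭_)
open import Data.Nat using (ℕ; zero; suc; _+_; _*_; _∸_; _≤ᵇ_; _<_; _≥_; NonZero)
open import Data.Nat.ListAction using (sum)
open import Data.Product using (_×_; _,_; ∃-syntax)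
open import Data.Product.Properties using (≡-dec)
open import Data.Sum using (_⊎_)
open import Relation.Binary.Definitions using (DecidableEquality)
open import Relation.Binary.PropositionalEquality using (_≡_; _≢_; refl; cong; cong₂; trans)
open import Relation.Nullary using (¬_)
open import Relation.Nullary.Decidable using (⌊_⌋)

ℤ² : Set
ℤ² = ℤ × ℤ

_≟²_ : DecidableEquality ℤ²
_≟²_ = ≡-dec ℤ._≟_ ℤ._≟_

-- A finite multiset is a list considered up to permutation.
record Neighborhood : Set where
  field
    elements : List ℤ²
    nonempty : elements ≢ []
    nonzero  : All (_≢ (0ℤ , 0ℤ)) elements

open Neighborhood public

infix 4 _≈_

_≈_ : Neighborhood → Neighborhood → Set
M ≈ N = elements M ↭ elements N

occurrences : ℤ² → List ℤ² → ℕ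
occurrences δ xs = length (filter (_≟² δ) xs)

mult : Neighborhood → ℤ² → ℕ
mult N δ = occurrences δ (elements N)

size : Neighborhood → ℕ
size N = length (elements N)

copies : ℕ → List ℤ² → List ℤ²
copies p xs = concat (replicate p xs)

infix 5 _^_∙_^_

_^_∙_^_ : Neighborhood → (p : ℕ) .{{_ : NonZero p}} →
          Neighborhood → (q : ℕ) .{{_ : NonZero q}} → Neighborhood
A ^ p ∙ B ^ q = record
  { elements = copies p (elements A) ++ copies q (elements B)
  ; nonempty = ne p (elements A) (nonempty A)
  ; nonzero  = All.++⁺ (All.concat⁺ (All.replicate⁺ p (nonzero A)))
                       (All.concat⁺ (All.replicate⁺ q (nonzero B)))
  }
  where
  ne : ∀ p .{{_ : NonZero p}} xs {ys : List ℤ²} → xs ≢ [] → copies p xs ++ ys ≢ []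
  ne (suc p) []       xs≢[] _ = ⊥-elim (xs≢[] refl)
  ne (suc p) (_ ∷ xs) _     ()

mult-^ : ∀ A p .{{_ : NonZero p}} B q .{{_ : NonZero q}} δ →
         mult (A ^ p ∙ B ^ q) δ ≡ p * mult A δ + q * mult B δ
mult-^ A p B q δ =
  trans (count-++ (copies p (elements A)) (copies q (elements B)))
        (cong₂ _+_ (count-copies p (elements A)) (count-copies q (elements B)))
  where
  count-++ : ∀ xs ys → occurrences δ (xs ++ ys) ≡ occurrences δ xs + occurrences δ ys
  count-++ xs ys = trans (cong length (filter-++ (_≟² δ) xs ys)) (length-++ (filter (_≟² δ) xs))

  count-copies : ∀ p xs → occurrences δ (copies p xs) ≡ p * occurrences δ xs
  count-copies zero    xs = refl
  count-copies (suc p) xs =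
    trans (count-++ xs (copies p xs)) (cong (occurrences δ xs +_) (count-copies p xs))

-- The pair (i , j) stands for the cell (i+1 , j+1) of {1,…,ℓ} × {1,…,ℓ′}.
Cell : ℕ → ℕ → Set
Cell ℓ ℓ′ = Fin ℓ × Fin ℓ′

record Grid : Set where
  field
    ℓ ℓ′ : ℕ
    ℓ≥1  : ℓ ≥ 1
    ℓ′≥1 : ℓ′ ≥ 1
    nbhd : Cell ℓ ℓ′ → Neighborhood

  V : Set
  V = Cell ℓ ℓ′

Uniform : Neighborhood → Grid → Set
Uniform N g = ∀ u → Grid.nbhd g u ≈ N

-- "Non-uniform" only means that the choice may depend on the cell.
NonUniform : Neighborhood → Neighborhood → Grid → Set
NonUniform A B g = ∀ u → Grid.nbhd g u ≈ A ⊎ Grid.nbhd g u ≈ B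

data Axis : Set where
  horizontal vertical : Axis

data Side : Set where
  north south west east : Side

axis : Side → Axis
axis north = vertical
axis south = vertical
axis west  = horizontal
axis east  = horizontal

opposite : Side → Side
opposite north = south
opposite south = north
opposite west  = east
opposite east  = west

module _ (g : Grid) where
  open Grid g

  _∈Edge_ : V → Side → Set
  (i , j) ∈Edge west  = toℕ i ≡ 0
  (i , j) ∈Edge east  = suc (toℕ i) ≡ ℓ
  (i , j) ∈Edge south = toℕ j ≡ 0
  (i , j) ∈Edge north = suc (toℕ j) ≡ ℓ′

  Corner : V → Set
  Corner u = ∃[ X ] ∃[ Y ] axis X ≢ axis Y × u ∈Edge X × u ∈Edge Y

  Configuration : Set
  Configuration = V → ℕ

  Stable : Configuration → Set
  Stable c = ∀ u → c u < size (nbhd u)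

  _≟ⱽ_ : DecidableEquality V
  _≟ⱽ_ = ≡-dec Fin._≟_ Fin._≟_

  addGrain : V → Configuration → Configuration
  addGrain x c u = if ⌊ u ≟ⱽ x ⌋ then suc (c u) else c u

  -- The δ with u + δ = v.
  displacement : V → V → ℤ²
  displacement (i , j) (i′ , j′) =
    (ℤ.+ toℕ i′ ℤ.- ℤ.+ toℕ i) , (ℤ.+ toℕ j′ ℤ.- ℤ.+ toℕ j)

  ΣV : (V → ℕ) → ℕ
  ΣV f = sum (map f (cartesianProduct (allFin ℓ) (allFin ℓ′)))

  record State : Set where
    constructor state
    field
      grains  : Configuration
      toppled : V → Bool

  open State public

  fires : State → V → Bool
  fires s u = not (toppled s u) ∧ (size (nbhd u) ≤ᵇ grains s u)

  -- The subtraction is never truncated, as a firing cell v contains at least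
  -- size (nbhd v) grains.
  step : State → State
  grains (step s) v =
    (grains s v ∸ (if fires s v then size (nbhd v) else 0))
      + ΣV (λ u → if fires s u then mult (nbhd u) (displacement u v) else 0)
  toppled (step s) v = toppled s v ∨ fires s v

  run : Configuration → ℕ → State
  run c zero    = state c (λ _ → false)
  run c (suc t) = step (run c t)

  Topples : Configuration → V → Set
  Topples c u = ∃[ t ] T (fires (run c t) u)

  Transports : Configuration → (x x′ : V) (Y′ : Side) → Set
  Transports c x x′ Y′ =
    Topples (addGrain x c) x′ × (∀ v → v ∈Edge Y′ → ¬ Topples (addGrain x c) v)

  CrossingGate : Configuration → Set
  CrossingGate c =
    Stable c ×
    (∃[ X ] ∃[ Y ] axis X ≢ axis Y ×
      (∃[ x ] ∃[ x′ ] ∃[ y ] ∃[ y′ ]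
        (x ∈Edge X × ¬ Corner x) × x′ ∈Edge opposite X ×
        (y ∈Edge Y × ¬ Corner y) × y′ ∈Edge opposite Y ×
        Transports c x x′ (opposite Y) ×
        Transports c y y′ (opposite X)))

  AdmitsCrossingGate : Set
  AdmitsCrossingGate = ∃[ c ] CrossingGate c

{-# OPTIONS --safe #-}

-- Only the displacements E = (1,0), N = (0,1) and J = (0,2) are used:
-- A = {E,N}, B = {J,J} for (a), and A = {E,N,J,J}, B = {E} for (b).
-- In a crossing gate let X be the cells toppled only with the grain at x, and Y
-- those toppled only with the grain at y. A cell of X other than x receives more
-- on the x-side than on the y-side, hence has a predecessor in X; so there are
-- disjoint paths from x to x′ in X and from y to y′ in Y, and one must jump over
-- a cell of the other. Suppose that each cell which can jump sends at least as
-- many grains to the north as any cell sends to the east. If such a cell v of Y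
-- lies just below a cell w of X, the grains from v to w outweigh those from the
-- western neighbour of w, so w must be reached by a jump from a cell of X just
-- below v. The roles of X and Y are now exchanged, and this goes on down to the
-- south edge, a contradiction.
module Submission where

open import Defs
open import Data.Bool using (Bool; true; false; T; not; _∧_; _∨_; if_then_else_)
import Data.Bool as Bool
open import Data.Bool.Properties using (∨-zeroʳ; T-≡; T-∨; ¬-not)
open import Data.Empty using (⊥)
open import Data.Fin using (toℕ; zero; suc)
import Data.Fin as Fin
open import Data.Fin.Properties using (all?; sequence; toℕ-injective; toℕ-inject₁; toℕ<n)
open import Data.Integer using (0ℤ)
import Data.Integer as ℤ
import Data.Integer.Properties as ℤ
open import Data.List using (List; []; _∷_; map; allFin; cartesianProduct; filter)
open import Data.List.Membership.Propositional using (_∈_)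
open import Data.List.Membership.Propositional.Properties using (∈-cartesianProduct⁺; ∈-allFin; ∈-filter⁻)
open import Data.List.Relation.Binary.Permutation.Propositional using (↭-refl)
open import Data.List.Relation.Binary.Permutation.Propositional.Properties using (filter-↭; ↭-length)
open import Data.List.Relation.Unary.All as All using (All; []; _∷_)
open import Data.List.Relation.Unary.AllPairs using (_∷_)
open import Data.List.Relation.Unary.Any using (here; there)
open import Data.List.Relation.Unary.Unique.Propositional using (Unique)
open import Data.List.Relation.Unary.Unique.Propositional.Properties using (cartesianProduct⁺; allFin⁺)
open import Data.Nat using (ℕ; zero; suc; _+_; _*_; _∸_; _≤ᵇ_; _≤_; _<_; z≤n; s≤s; _≟_; _≤?_; _<?_; NonZero)
open import Data.Nat.ListAction using (sum)
open import Data.Nat.Properties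
open import Algebra.Properties.CommutativeSemigroup +-commutativeSemigroup using (interchange; xy∙z≈xz∙y)
open import Data.Product using (_×_; _,_; proj₁; proj₂; ∃-syntax)
open import Data.Sum as Sum using (_⊎_; inj₁; inj₂; [_,_]′)
open import Data.Unit using (tt)
open import Effect.Monad using (module RawMonad)
open import Function using (_∘_)
open import Function.Bundles using (module Equivalence)
open import Level using (0ℓ)
open import Relation.Binary.Definitions using (DecidableEquality)
open import Relation.Binary.PropositionalEquality
open import Relation.Nullary using (¬_; Dec; yes; no; contradiction)
open import Relation.Nullary.Decidable using (True; toWitness; ⌊_⌋; _→-dec_; ¬¬-excluded-middle)
open import Relation.Nullary.Negation using (¬¬-Monad)
open import Relation.Unary using (Decidable)

open Equivalence using (to; from)

-- Sums over lists.

module _ {A : Set} where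

  sum-map-cong : ∀ {f h : A → ℕ} → (∀ a → f a ≡ h a) → ∀ xs → sum (map f xs) ≡ sum (map h xs)
  sum-map-cong f≗h []       = refl
  sum-map-cong f≗h (x ∷ xs) = cong₂ _+_ (f≗h x) (sum-map-cong f≗h xs)

  sum-map-+ : ∀ (f h : A → ℕ) xs → sum (map (λ a → f a + h a) xs) ≡ sum (map f xs) + sum (map h xs)
  sum-map-+ f h []       = refl
  sum-map-+ f h (x ∷ xs) rewrite sum-map-+ f h xs =
    interchange (f x) (h x) (sum (map f xs)) (sum (map h xs))

  sum-map-mono : ∀ {f h : A → ℕ} → (∀ a → f a ≤ h a) → ∀ xs → sum (map f xs) ≤ sum (map h xs)
  sum-map-mono f≤h []       = z≤n
  sum-map-mono f≤h (x ∷ xs) = +-mono-≤ (f≤h x) (sum-map-mono f≤h xs)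

  -- Pigeonhole: turns an excess of received grains into one particular sender.
  sum-map-<⇒∃ : ∀ (f h : A → ℕ) xs → sum (map f xs) < sum (map h xs) → ∃[ a ] f a < h a
  sum-map-<⇒∃ f h (x ∷ xs) lt with f x <? h x
  ... | yes fx<hx = x , fx<hx
  ... | no  fx≮hx = sum-map-<⇒∃ f h xs
    (≰⇒> λ ge → <⇒≱ lt (+-mono-≤ (≮⇒≥ fx≮hx) ge))

  ∈⇒≤sum-map : ∀ (f : A → ℕ) {a xs} → a ∈ xs → f a ≤ sum (map f xs)
  ∈⇒≤sum-map f (here refl)               = m≤m+n _ _
  ∈⇒≤sum-map f {xs = x ∷ _} (there a∈xs) = ≤-trans (∈⇒≤sum-map f a∈xs) (m≤n+m _ (f x))

  module _ (_≟_ : DecidableEquality A) where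

    -- Lets a counting argument place an extra weight `k` on a single cell.
    sum-map-indicator : ∀ k {a xs} → Unique xs → a ∈ xs →
                        sum (map (λ b → if ⌊ b ≟ a ⌋ then k else 0) xs) ≡ k
    sum-map-indicator k {a} (x∉xs ∷ _) (here refl) with a ≟ a
    ... | yes _   = trans (cong (k +_) (absent x∉xs)) (+-identityʳ k)
      where
      absent : ∀ {ys} → All (a ≢_) ys → sum (map (λ b → if ⌊ b ≟ a ⌋ then k else 0) ys) ≡ 0
      absent []           = refl
      absent {y ∷ _} (a≢y ∷ a∉ys) with y ≟ a
      ... | yes y≡a = contradiction (sym y≡a) a≢y
      ... | no  _   = absent a∉ys
    ... | no  a≢a = contradiction refl a≢a
    sum-map-indicator k {a} {x ∷ _} (x∉xs ∷ uniq) (there a∈xs) with x ≟ a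
    ... | yes x≡a = contradiction x≡a (All.lookup x∉xs a∈xs)
    ... | no  _   = sum-map-indicator k uniq a∈xs

-- Grain balance and closed sets of toppled cells.

module Dynamics (g : Grid) where
  open Grid g

  cells : List V
  cells = cartesianProduct (allFin ℓ) (allFin ℓ′)

  ∈-cells : ∀ u → u ∈ cells
  ∈-cells (i , j) = ∈-cartesianProduct⁺ (∈-allFin i) (∈-allFin j)

  ΣV-indicator : ∀ k a → ΣV g (λ b → if ⌊ _≟ⱽ_ g b a ⌋ then k else 0) ≡ k
  ΣV-indicator k a = sum-map-indicator (_≟ⱽ_ g) k (cartesianProduct⁺ (allFin⁺ ℓ) (allFin⁺ ℓ′)) (∈-cells a)

  sent : V → V → ℕ
  sent u v = mult (nbhd u) (displacement g u v)

  received : (V → Bool) → V → ℕ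
  received S v = ΣV g (λ u → if S u then sent u v else 0)

  received-mono : ∀ {S S′} → (∀ u → S u ≡ true → S′ u ≡ true) → ∀ v → received S v ≤ received S′ v
  received-mono {S} {S′} S⊆S′ v = sum-map-mono pointwise cells
    where
    pointwise : ∀ u → (if S u then sent u v else 0) ≤ (if S′ u then sent u v else 0)
    pointwise u with S u in eq
    ... | false = z≤n
    ... | true rewrite S⊆S′ u eq = ≤-refl

  private
    -- One time step at one cell, in plain numbers: `b` is the old toppled flag, `z` the threshold,
    -- `n` the current and `c` the initial grains, `r` and `r′` the grains received before and
    -- during the step.
    balance-step : ∀ b z n c r r′ → n + (if b then z else 0) ≡ c + r →
      let f = not b ∧ (z ≤ᵇ n) in
      (n ∸ (if f then z else 0)) + r′ + (if b ∨ f then z else 0) ≡ c + (r + r′)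
    balance-step true z n c r r′ eq = begin
      n + r′ + z    ≡⟨ xy∙z≈xz∙y n r′ z ⟩
      (n + z) + r′  ≡⟨ cong (_+ r′) eq ⟩
      c + r + r′    ≡⟨ +-assoc c r r′ ⟩
      c + (r + r′)  ∎
      where open ≡-Reasoning
    balance-step false z n c r r′ eq with z ≤ᵇ n in z≤ᵇn
    ... | true = begin
      (n ∸ z) + r′ + z    ≡⟨ xy∙z≈xz∙y (n ∸ z) r′ z ⟩
      (n ∸ z + z) + r′    ≡⟨ cong (_+ r′) (m∸n+n≡m (≤ᵇ⇒≤ z n (subst T (sym z≤ᵇn) tt))) ⟩
      n + r′              ≡⟨ cong (_+ r′) (trans (sym (+-identityʳ n)) eq) ⟩
      c + r + r′          ≡⟨ +-assoc c r r′ ⟩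
      c + (r + r′)        ∎
      where open ≡-Reasoning
    ... | false = begin
      n + r′ + 0    ≡⟨ xy∙z≈xz∙y n r′ 0 ⟩
      (n + 0) + r′  ≡⟨ cong (_+ r′) eq ⟩
      c + r + r′    ≡⟨ +-assoc c r r′ ⟩
      c + (r + r′)  ∎
      where open ≡-Reasoning

  -- Conservation of grains: a cell topples at most once, so its flag alone determines how many
  -- grains it has lost.
  balance : ∀ c t v → grains (run g c t) v + (if toppled (run g c t) v then size (nbhd v) else 0)
                      ≡ c v + received (toppled (run g c t)) v
  balance c zero v = cong (c v +_) (sym (nothing cells))
    where
    nothing : ∀ (us : List V) → sum (map (λ _ → 0) us) ≡ 0
    nothing []       = refl
    nothing (_ ∷ us) = nothing us
  balance c (suc t) v = trans
    (balance-step (toppled s v) (size (nbhd v)) (grains s v) (c v) _ _ (balance c t v))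
    (cong (c v +_) (trans (sym (sum-map-+ _ _ cells)) (sum-map-cong disjoint cells)))
    where
    s = run g c t
    -- A firing cell has not toppled before, so no sender is counted twice.
    disjoint : ∀ u → (if toppled s u then sent u v else 0) + (if fires g s u then sent u v else 0)
                     ≡ (if toppled s u ∨ fires g s u then sent u v else 0)
    disjoint u with toppled s u
    ... | true  = +-identityʳ _
    ... | false = refl

  Toppled : Configuration g → ℕ → V → Set
  Toppled c t u = toppled (run g c t) u ≡ true

  Topples⇒Toppled : ∀ {c u} → Topples g c u → ∃[ t ] Toppled c t u
  Topples⇒Toppled {c} {u} (t , fire) with fires g (run g c t) u in eq
  ... | true = suc t , trans (cong (toppled (run g c t) u ∨_) eq) (∨-zeroʳ _)

  Toppled⇒Topples : ∀ {c} t {u} → Toppled c t u → Topples g c u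
  Toppled⇒Topples {c} (suc t) {u} eq =
    [ Toppled⇒Topples t ∘ to T-≡ , t ,_ ]′ (to T-∨ (from T-≡ eq))

  Toppled-mono : ∀ {c t t′ u} → t ≤ t′ → Toppled c t u → Toppled c t′ u
  Toppled-mono {c} {t} {t′} {u} t≤t′ eq = subst (λ k → Toppled c k u) (m∸n+n≡m t≤t′) (later (t′ ∸ t))
    where
    later : ∀ k → Toppled c (k + t) u
    later zero    = eq
    later (suc k) rewrite later k = refl

  toppled⇒enough : ∀ {c t u} → Toppled c t u → size (nbhd u) ≤ c u + received (toppled (run g c t)) u
  toppled⇒enough {c} {t} {u} eq with toppled (run g c t) u | balance c t u
  toppled⇒enough {u = u} refl | .true | bal = subst (size (nbhd u) ≤_) bal (m≤n+m _ _)

  -- If exactly the cells of `S` had toppled, no further cell could.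
  Closed : Configuration g → (V → Bool) → Set
  Closed c S = ∀ u → S u ≡ false → c u + received S u < size (nbhd u)

  -- Induction on time: as long as all toppled cells lie in `S`, a cell outside has received at most
  -- what `S` sends it, which is below its threshold.
  toppled⊆closed : ∀ {c S} → Closed c S → ∀ t u → Toppled c t u → S u ≡ true
  toppled⊆closed {c} {S} closed (suc t) u eq
    with toppled (run g c t) u in before | S u in Su | balance c t u
  ... | true  | _     | _   = trans (sym Su) (toppled⊆closed closed t u before)
  ... | false | true  | _   = refl
  ... | false | false | bal with size (nbhd u) ≤ᵇ grains (run g c t) u in enough
  ... | true = contradiction (closed u Su) (≤⇒≯ (begin
      size (nbhd u)                            ≤⟨ ≤ᵇ⇒≤ _ _ (subst T (sym enough) tt) ⟩
      grains (run g c t) u                     ≡⟨ trans (sym (+-identityʳ _)) bal ⟩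
      c u + received (toppled (run g c t)) u   ≤⟨ +-monoʳ-≤ (c u) (received-mono (toppled⊆closed closed t) u) ⟩
      c u + received S u                       ∎))
    where open ≤-Reasoning

  -- Which cells topple is only needed under a negated goal, so the time after
  -- which nothing happens need not be computed.
  Final : Configuration g → ℕ → Set
  Final c t = ∀ u → Topples g c u → Toppled c t u

  -- Excluded middle holds at each cell under double negation, and double negation commutes with the
  -- finite products over columns and rows.
  ¬¬final : ∀ c → ¬ ¬ (∃[ t ] Final c t)
  ¬¬final c = collect <$> sequence rawApplicative (λ i → sequence rawApplicative (λ j → time (i , j)))
    where
    open RawMonad (¬¬-Monad {0ℓ})
    time : ∀ u → ¬ ¬ (∃[ t ] (Topples g c u → Toppled c t u))
    time u = choose <$> ¬¬-excluded-middle
      where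
      choose : _ → ∃[ t ] (Topples g c u → Toppled c t u)
      choose (yes top) = let t , eq = Topples⇒Toppled top in t , λ _ → eq
      choose (no ¬top) = 0 , λ top → contradiction top ¬top
    collect : (∀ i j → ∃[ t ] (Topples g c (i , j) → Toppled c t (i , j))) → ∃[ t ] Final c t
    -- The sum of the individual times bounds each of them.
    collect times = ΣV g t , λ u top → Toppled-mono (∈⇒≤sum-map t (∈-cells u)) (proj₂ (times _ _) top)
      where
      t : V → ℕ
      t (i , j) = proj₁ (times i j)

  -- By `balance`, an untoppled cell with enough grains would fire at time `t`, and finality would
  -- count it as toppled already.
  final⇒closed : ∀ {c t} → Final c t → Closed c (toppled (run g c t))
  final⇒closed {c} {t} final u eq with size (nbhd u) ≤? c u + received (toppled (run g c t)) u
  ... | no ¬enough = ≰⇒> ¬enough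
  ... | yes enough = contradiction (trans (sym eq) (final u (t , fire))) λ ()
    where
    fire : T (fires g (run g c t) u)
    fire with toppled (run g c t) u | balance c t u
    fire | true  | _   = contradiction eq λ ()
    fire | false | bal = ≤⇒≤ᵇ (subst (size (nbhd u) ≤_) (trans (sym bal) (+-identityʳ _)) enough)

-- Displacements and coordinates.

eastward northward northward² : ℤ²
eastward   = ℤ.+ 1 , ℤ.+ 0
northward  = ℤ.+ 0 , ℤ.+ 1
northward² = ℤ.+ 0 , ℤ.+ 2

diff⇒sum : ∀ {m n k} → ℤ.+ m ℤ.- ℤ.+ n ≡ ℤ.+ k → m ≡ k + n
diff⇒sum {m} {n} {k} eq = ℤ.+-injective (begin
  ℤ.+ m                            ≡⟨ ℤ.+-identityʳ (ℤ.+ m) ⟨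
  ℤ.+ m ℤ.+ ℤ.0ℤ                   ≡⟨ cong (λ z → ℤ.+ m ℤ.+ z) (ℤ.+-inverseˡ (ℤ.+ n)) ⟨
  ℤ.+ m ℤ.+ (ℤ.- ℤ.+ n ℤ.+ ℤ.+ n)  ≡⟨ ℤ.+-assoc (ℤ.+ m) (ℤ.- ℤ.+ n) (ℤ.+ n) ⟨
  ℤ.+ m ℤ.- ℤ.+ n ℤ.+ ℤ.+ n        ≡⟨ cong (ℤ._+ ℤ.+ n) eq ⟩
  ℤ.+ (k + n)                      ∎)
  where open ≡-Reasoning

sum⇒diff : ∀ {m n} k → m ≡ k + n → ℤ.+ m ℤ.- ℤ.+ n ≡ ℤ.+ k
sum⇒diff {n = n} k refl = begin
  ℤ.+ k ℤ.+ ℤ.+ n ℤ.- ℤ.+ n    ≡⟨ ℤ.+-assoc (ℤ.+ k) (ℤ.+ n) (ℤ.- ℤ.+ n) ⟩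
  ℤ.+ k ℤ.+ (ℤ.+ n ℤ.- ℤ.+ n)  ≡⟨ cong (λ z → ℤ.+ k ℤ.+ z) (ℤ.+-inverseʳ (ℤ.+ n)) ⟩
  ℤ.+ k ℤ.+ ℤ.0ℤ               ≡⟨ ℤ.+-identityʳ (ℤ.+ k) ⟩
  ℤ.+ k                        ∎
  where open ≡-Reasoning

-- Impossibility of a crossing when jumping cells send enough grains north.

module NoCrossing
  (g : Grid) (K : ℕ)
  (arcs    : ∀ u {δ} → 0 < mult (Grid.nbhd g u) δ → δ ≡ eastward ⊎ δ ≡ northward ⊎ δ ≡ northward²)
  (east≤K  : ∀ u → mult (Grid.nbhd g u) eastward ≤ K)
  (K≤north : ∀ u → 0 < mult (Grid.nbhd g u) northward² → K ≤ mult (Grid.nbhd g u) northward)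
  where

  open Grid g
  open Dynamics g

  col row : V → ℕ
  col (i , _) = toℕ i
  row (_ , j) = toℕ j

  cell-≡ : ∀ {u v} → col u ≡ col v → row u ≡ row v → u ≡ v
  cell-≡ p q = cong₂ _,_ (toℕ-injective p) (toℕ-injective q)

  _⟨_,_⟩↦_ : V → ℕ → ℕ → V → Set
  u ⟨ a , b ⟩↦ v = col v ≡ a + col u × row v ≡ b + row u

  data Arc (u v : V) : Set where
    east  : u ⟨ 1 , 0 ⟩↦ v → sent u v ≤ K → Arc u v
    north : u ⟨ 0 , 1 ⟩↦ v → Arc u v
    jump  : u ⟨ 0 , 2 ⟩↦ v → 0 < mult (nbhd u) northward² → Arc u v

  ↦⇒displacement : ∀ {u v a b} → u ⟨ a , b ⟩↦ v → displacement g u v ≡ (ℤ.+ a , ℤ.+ b)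
  ↦⇒displacement (p , q) = cong₂ _,_ (sum⇒diff _ p) (sum⇒diff _ q)

  displacement⇒↦ : ∀ {u v a b} → displacement g u v ≡ (ℤ.+ a , ℤ.+ b) → u ⟨ a , b ⟩↦ v
  displacement⇒↦ eq = diff⇒sum (cong proj₁ eq) , diff⇒sum (cong proj₂ eq)

  arc : ∀ {u v} → 0 < sent u v → Arc u v
  arc {u} {v} 0<sent with arcs u 0<sent
  ... | inj₁ eq        = east (displacement⇒↦ eq) (subst (λ δ → mult (nbhd u) δ ≤ K) (sym eq) (east≤K u))
  ... | inj₂ (inj₁ eq) = north (displacement⇒↦ eq)
  ... | inj₂ (inj₂ eq) = jump (displacement⇒↦ eq) (subst (λ δ → 0 < mult (nbhd u) δ) eq 0<sent)

  -- The only possible cell with an arc to the east into w, and a junk value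
  -- when there is none.
  westOf : V → V
  westOf (i , j) = Fin.pred i , j

  westOf-↦ : ∀ {u w} → u ⟨ 1 , 0 ⟩↦ w → u ≡ westOf w
  westOf-↦ {w = Fin.suc i , _} (p , q) = cell-≡ (trans (sym (suc-injective p)) (sym (toℕ-inject₁ i))) (sym q)

  -- The termination measure for walking back along arcs, each of which increases it.
  height : V → ℕ
  height u = col u + row u

  arc-height : ∀ {u v} → Arc u v → height u < height v
  arc-height {u} {v} (east (p , q) _) rewrite p | q = ≤-refl
  arc-height {u} {v} (north (p , q)) rewrite p | q = ≤-reflexive (sym (+-suc (col u) (row u)))
  arc-height {u} {v} (jump (p , q) _) rewrite p | q = +-monoʳ-< (col u) (m≤n⇒m≤1+n (n<1+n _))

  -- At cells other than `x`, toppling on one side only must be explained by received grains, not by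
  -- the added one.
  Excess : (S S′ : V → Bool) → V → Set
  Excess S S′ x = ∀ u → S u ≡ true → S′ u ≡ false → u ≢ x → received S′ u < received S u

  -- S stands for the cells toppled after a grain is added at x, and S′ for those
  -- toppled after a grain is added elsewhere.
  module Difference
    (S S′ : V → Bool) (x : V) (excess : Excess S S′ x) where

    D : V → Set
    D u = S u ≡ true × S′ u ≡ false

    -- Some sender contributes strictly more under `S` than under `S′`, which forces it to lie in
    -- `S` and not in `S′`.
    predecessor : ∀ {u} → D u → u ≢ x → ∃[ v ] D v × Arc v u
    predecessor {u} (Su , S′u) u≢x
      with v , lt ← sum-map-<⇒∃ (λ v → if S′ v then sent v u else 0) (λ v → if S v then sent v u else 0) cells
                      (excess u Su S′u u≢x)
      with S v in Sv | S′ v in S′v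
    ... | true  | false = v , (Sv , S′v) , arc lt
    ... | true  | true  = contradiction lt (<-irrefl refl)
    ... | false | true  = contradiction lt λ ()
    ... | false | false = contradiction lt λ ()

    -- Predecessors lead back to `x`, and arcs go only east or north.
    origin≤ : ∀ {u} → D u → col x ≤ col u × row x ≤ row u
    origin≤ Du = go _ Du ≤-refl
      where
      go : ∀ k {u} → D u → height u < k → col x ≤ col u × row x ≤ row u
      go (suc k) {u} Du (s≤s hu≤k) with _≟ⱽ_ g u x
      ... | yes refl = ≤-refl , ≤-refl
      ... | no u≢x with v , Dv , v→u ← predecessor Du u≢x
                   with p , q ← go k Dv (<-≤-trans (arc-height v→u) hu≤k) | v→u
      ... | east  (c , r) _ = ≤-trans p (subst (col v ≤_) (sym c) (n≤1+n _)) , ≤-trans q (≤-reflexive (sym r))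
      ... | north (c , r)   = ≤-trans p (≤-reflexive (sym c)) , ≤-trans q (subst (row v ≤_) (sym r) (n≤1+n _))
      ... | jump  (c , r) _ = ≤-trans p (≤-reflexive (sym c)) , ≤-trans q (subst (row v ≤_) (sym r) (m≤n+m _ 2))

    -- The K grains that v sends to w make up for those that the western
    -- neighbour may send, so the excess at w must come through a jump.
    jump-below : ∀ {v w} → D w → w ≢ x → S v ≡ false → S′ v ≡ true →
                 v ⟨ 0 , 1 ⟩↦ w → 0 < mult (nbhd v) northward² →
                 ∃[ u ] D u × u ⟨ 0 , 1 ⟩↦ v × 0 < mult (nbhd u) northward²
    jump-below {v} {w} (Sw , S′w) w≢x Sv S′v v↦w v-jumps = locate (sum-map-<⇒∃ _ _ cells totals)
      where
      in-S in-S′ at-v at-west : V → ℕ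
      in-S    u = if S u then sent u w else 0
      in-S′   u = if S′ u then sent u w else 0
      at-v    u = if ⌊ _≟ⱽ_ g u v ⌋ then K else 0
      at-west u = if ⌊ _≟ⱽ_ g u (westOf w) ⌋ then K else 0

      -- The excess at `w` survives adding `K` on both sides, credited to `v` under `S` and to the
      -- western neighbour under `S′`.
      totals : ΣV g (λ u → in-S′ u + at-west u) < ΣV g (λ u → in-S u + at-v u)
      totals = subst₂ _<_
        (sym (trans (sum-map-+ in-S′ at-west cells) (cong (received S′ w +_) (ΣV-indicator K (westOf w)))))
        (sym (trans (sum-map-+ in-S at-v cells) (cong (received S w +_) (ΣV-indicator K v))))
        (+-monoˡ-< K (excess w Sw S′w w≢x))

      K≤sent : K ≤ sent v w
      K≤sent = subst (λ δ → K ≤ mult (nbhd v) δ) (sym (↦⇒displacement v↦w)) (K≤north v v-jumps)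

      locate : ∃[ u ] in-S′ u + at-west u < in-S u + at-v u → _
      locate (u , lt) with _≟ⱽ_ g u v
      -- The sender `v` is in `S′` only and sends at least `K`, which absorbs its credit.
      locate (u , lt) | yes refl = contradiction
        (subst₂ (λ b b′ → (if b then sent u w else 0) + K ≤ (if b′ then sent u w else 0) + at-west u)
                (sym Sv) (sym S′v) (≤-trans K≤sent (m≤m+n _ _)))
        (<⇒≱ lt)
      locate (u , lt) | no u≢v with S u in Su | S′ u in S′u
      ... | false | _    = contradiction lt λ ()
      ... | true  | true = contradiction (subst (_≤ sent u w + at-west u) (sym (+-identityʳ _)) (m≤m+n _ _)) (<⇒≱ lt)
      ... | true  | false with arc (<-≤-trans (≤-<-trans z≤n lt) (≤-reflexive (+-identityʳ _)))
      ... | jump (c , r) u-jumps =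
        u , (Su , S′u) , (trans (sym (proj₁ v↦w)) c , suc-injective (trans (sym (proj₂ v↦w)) r)) , u-jumps
      -- Only `v` has a northward arc into `w`.
      ... | north (c , r) =
        contradiction (cell-≡ (trans (sym c) (proj₁ v↦w)) (suc-injective (trans (sym r) (proj₂ v↦w)))) u≢v
      ... | east u↦w sent≤K with _≟ⱽ_ g u (westOf w)
      -- The western neighbour sends at most `K`, which its own credit absorbs.
      ...   | yes _ = contradiction (subst (_≤ K) (sym (+-identityʳ _)) sent≤K) (<⇒≱ lt)
      ...   | no u≢ = contradiction (westOf-↦ u↦w) u≢

    -- Walk back from u towards x: no arc leads down.
    column : col x ≡ 0 → ∀ {u} → D u → ∀ {k} → k ≤ col u → ∃[ v ] D v × col v ≡ k × row v ≤ row u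
    column x-west Du = go _ Du ≤-refl
      where
      go : ∀ n {u} → D u → height u < n → ∀ {k} → k ≤ col u → ∃[ v ] D v × col v ≡ k × row v ≤ row u
      go (suc n) {u} Du (s≤s hu≤n) {k} k≤col with k ≟ col u
      ... | yes k≡col = u , Du , sym k≡col , ≤-refl
      ... | no  k≢col with k<col ← ≤∧≢⇒< k≤col k≢col
                      -- `x` has column 0, whereas `u` lies strictly east of column `k`.
                      with v , Dv , v→u ← predecessor Du (λ where refl → <⇒≢ (≤-<-trans z≤n k<col) (sym x-west))
        = weaken v→u (go n Dv (<-≤-trans (arc-height v→u) hu≤n) (k≤ v→u))
        where
        k≤ : ∀ {v} → Arc v u → k ≤ col v
        k≤ (east (c , _) _) = ≤-pred (subst (k <_) c k<col)
        k≤ (north (c , _))  = subst (k ≤_) c k≤col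
        k≤ (jump (c , _) _) = subst (k ≤_) c k≤col
        weaken : ∀ {v} → Arc v u → ∃[ w ] D w × col w ≡ k × row w ≤ row v → ∃[ w ] D w × col w ≡ k × row w ≤ row u
        weaken (east  (_ , r) _) (w , Dw , cw , le) = w , Dw , cw , subst (row w ≤_) (sym r) le
        weaken (north (_ , r))   (w , Dw , cw , le) = w , Dw , cw , subst (row w ≤_) (sym r) (m≤n⇒m≤o+n 1 le)
        weaken (jump  (_ , r) _) (w , Dw , cw , le) = w , Dw , cw , subst (row w ≤_) (sym r) (m≤n⇒m≤o+n 2 le)

  -- Two disjoint paths, from the west and from the south.

  module _
    (Sˣ Sʸ : V → Bool) (x y : V)
    (excessˣ : Excess Sˣ Sʸ x)
    (excessʸ : Excess Sʸ Sˣ y)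
    (x-west : col x ≡ 0) (y-south : row y ≡ 0) (y-not-west : 0 < col y)
    where

    module X = Difference Sˣ Sʸ x excessˣ
    module Y = Difference Sʸ Sˣ y excessʸ

    disjoint : ∀ {u} → X.D u → ¬ Y.D u
    disjoint (_ , Sʸu) (Sʸu′ , _) = contradiction (trans (sym Sʸu) Sʸu′) λ ()

    -- Cells of the y-side lie no further west than `y`, which is off the west edge.
    x-not-above-Y : ∀ {v} → Y.D v → ¬ v ⟨ 0 , 1 ⟩↦ x
    x-not-above-Y Yv (c , _) = <⇒≢ (<-≤-trans y-not-west (proj₁ (Y.origin≤ Yv))) (trans (sym x-west) c)

    y-not-above : ∀ {v} → ¬ v ⟨ 0 , 1 ⟩↦ y
    y-not-above (_ , r) = 0≢1+n (trans (sym y-south) r)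

    mutual
      -- Infinite descent: `jump-below` gives a jumping cell of the x-side just under `v`, which is
      -- the situation of `¬X-under-Y` one row lower. The bound `n` on the row makes the recursion
      -- structural.
      ¬Y-under-X : ∀ n {v w} → row v < n → X.D w → Y.D v → v ⟨ 0 , 1 ⟩↦ w → ¬ 0 < mult (nbhd v) northward²
      ¬Y-under-X (suc n) {v} {w} (s≤s v≤n) Xw Yv@(Sʸv , Sˣv) v↦w v-jumps
        with u , Xu , u↦v , u-jumps ← X.jump-below Xw (λ where refl → x-not-above-Y Yv v↦w) Sˣv Sʸv v↦w v-jumps
        = ¬X-under-Y n (≤-trans (≤-reflexive (sym (proj₂ u↦v))) v≤n) Yv Xu u↦v u-jumps

      ¬X-under-Y : ∀ n {v w} → row v < n → Y.D w → X.D v → v ⟨ 0 , 1 ⟩↦ w → ¬ 0 < mult (nbhd v) northward²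
      ¬X-under-Y (suc n) {v} {w} (s≤s v≤n) Yw Xv@(Sˣv , Sʸv) v↦w v-jumps
        with u , Yu , u↦v , u-jumps ← Y.jump-below Yw (λ where refl → y-not-above v↦w) Sʸv Sˣv v↦w v-jumps
        = ¬Y-under-X n (≤-trans (≤-reflexive (sym (proj₂ u↦v))) v≤n) Xv Yu u↦v u-jumps

    -- Walking back from q towards y stays above a cell of the x-side, which is
    -- impossible at y on the south edge.
    ¬Y-above-X : ∀ n {q w} → height q < n → Y.D q → X.D w → col w ≡ col q → ¬ row w < row q
    ¬Y-above-X (suc n) {q} {w} (s≤s q≤n) Yq Xw cols w<q
      with u , Yu , u→q ← Y.predecessor Yq (λ where refl → <⇒≢ (≤-<-trans z≤n w<q) (sym y-south))
      with recur ← (λ {w} → ¬Y-above-X n {w = w} (<-≤-trans (arc-height u→q) q≤n) Yu) | u→q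
    -- The walk moves one column west in the same row; `X.column` moves the lower cell along without
    -- raising it.
    ... | east (c , r) _
      with w′ , Xw′ , cols′ , w′≤w ← X.column x-west Xw (subst (col u ≤_) (sym (trans cols c)) (n≤1+n _))
      = recur Xw′ cols′ (subst (row w′ <_) r (≤-<-trans w′≤w w<q))
    ... | north (c , r) = recur Xw (trans cols c) (≤∧≢⇒< (≤-pred (subst (row w <_) r w<q)) rows≢)
      where
      rows≢ : row w ≢ row u
      rows≢ eq = disjoint Xw (subst Y.D (sym (cell-≡ (trans cols c) eq)) Yu)
    -- Besides `w` being `u` itself, the jump could pass over `w` with `u` just below it;
    -- `¬Y-under-X` rules this out.
    ... | jump (c , r) u-jumps =
      recur Xw (trans cols c) (≤∧≢⇒< (≤-pred (≤∧≢⇒< (≤-pred (subst (row w <_) r w<q)) not-next)) rows≢)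
      where
      rows≢ : row w ≢ row u
      rows≢ eq = disjoint Xw (subst Y.D (sym (cell-≡ (trans cols c) eq)) Yu)
      not-next : row w ≢ suc (row u)
      not-next eq = ¬Y-under-X _ ≤-refl Xw Yu (trans cols c , eq) u-jumps

  -- From crossing gates to separated paths.

  ≤addGrain : ∀ {c u x} → c u ≤ addGrain g x c u
  ≤addGrain {u = u} {x} with _≟ⱽ_ g u x
  ... | yes _ = n≤1+n _
  ... | no  _ = ≤-refl

  addGrain-other : ∀ {c u x} → u ≢ x → addGrain g x c u ≡ c u
  addGrain-other {u = u} {x} u≢x with _≟ⱽ_ g u x
  ... | yes u≡x = contradiction u≡x u≢x
  ... | no  _   = refl

  -- The threshold of `u` is met on the x-side and, by closedness, missed on the y-side; both start
  -- with `c u` grains at `u`, up to a grain that only helps the y-side.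
  final-excess : ∀ {c x y t t′} → Final (addGrain g y c) t′ →
    Excess (toppled (run g (addGrain g x c) t)) (toppled (run g (addGrain g y c) t′)) x
  final-excess {c} {x} {y} {t} {t′} final′ u Su S′u u≢x = +-cancelˡ-< (c u) _ _ (begin-strict
    c u + received S′ u                   ≤⟨ +-monoˡ-≤ _ (≤addGrain {c} {u} {y}) ⟩
    addGrain g y c u + received S′ u      <⟨ final⇒closed {t = t′} final′ u S′u ⟩
    size (nbhd u)                         ≤⟨ toppled⇒enough {t = t} Su ⟩
    addGrain g x c u + received S u       ≡⟨ cong (_+ received S u) (addGrain-other {c} u≢x) ⟩
    c u + received S u                    ∎)
    where
    open ≤-Reasoning
    S  = toppled (run g (addGrain g x c) t)
    S′ = toppled (run g (addGrain g y c) t′)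

  separated : ∀ Sˣ Sʸ {x y} (exˣ : Excess Sˣ Sʸ x) (exʸ : Excess Sʸ Sˣ y) X Y →
    axis X ≡ horizontal → axis Y ≡ vertical →
    ∀ {x′ y′} →
    _∈Edge_ g x X → ¬ Corner g x → _∈Edge_ g y Y → ¬ Corner g y →
    Sˣ x′ ≡ true × Sʸ x′ ≡ false → Sʸ y′ ≡ true × Sˣ y′ ≡ false →
    _∈Edge_ g x′ (opposite X) → _∈Edge_ g y′ (opposite Y) → ⊥
  -- Going from east to west is possible only in a grid of width 1, where `y` would be a corner.
  separated Sˣ Sʸ {x} {y} exˣ exʸ east Y _ Y-vert {x′} x∈X x-inner y∈Y y-inner Dx′ Dy′ x′∈X′ y′∈Y′ =
    y-inner (west , Y , (λ eq → contradiction (trans eq Y-vert) λ ()) , y-west , y∈Y)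
    where
    ℓ≤1 : ℓ ≤ 1
    ℓ≤1 = subst (_≤ 1) x∈X (s≤s (subst (col x ≤_) x′∈X′ (proj₁ (Difference.origin≤ Sˣ Sʸ x exˣ Dx′))))
    y-west : col y ≡ 0
    y-west = n<1⇒n≡0 (<-≤-trans (toℕ<n (proj₁ y)) ℓ≤1)
  -- Likewise, going from north to south forces height 1, and `x` would be a corner.
  separated Sˣ Sʸ {x} {y} exˣ exʸ west north _ _ x∈X x-inner y∈Y y-inner Dx′ Dy′ x′∈X′ y′∈Y′ =
    x-inner (west , south , (λ ()) , x∈X , x-south)
    where
    ℓ′≤1 : ℓ′ ≤ 1
    ℓ′≤1 = subst (_≤ 1) y∈Y (s≤s (subst (row y ≤_) y′∈Y′ (proj₂ (Difference.origin≤ Sʸ Sˣ y exʸ Dy′))))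
    x-south : row x ≡ 0
    x-south = n<1⇒n≡0 (<-≤-trans (toℕ<n (proj₂ x)) ℓ′≤1)
  -- The x-side reaches the last column, so it has a cell in the column of `y′`; as `y′` is in the
  -- top row, that cell lies below it.
  separated Sˣ Sʸ {x} {y} exˣ exʸ west south _ _ {x′} {y′} x-west x-inner y-south y-inner Dx′ Dy′ x′∈east y′∈north
    with w , Dw , cols , _ ← Difference.column Sˣ Sʸ x exˣ x-west Dx′
           (≤-pred (subst (col y′ <_) (sym x′∈east) (toℕ<n (proj₁ y′))))
    = ¬Y-above-X Sˣ Sʸ x y exˣ exʸ x-west y-south y-not-west _ ≤-refl Dy′ Dw cols
        (≤∧≢⇒< (≤-pred (subst (row w <_) (sym y′∈north) (toℕ<n (proj₂ w)))) rows≢)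
    where
    y-not-west : 0 < col y
    y-not-west = n≢0⇒n>0 λ y-west → y-inner (west , south , (λ ()) , y-west , y-south)
    rows≢ : row w ≢ row y′
    rows≢ eq with refl ← cell-≡ {w} {y′} cols eq = contradiction (trans (sym (proj₂ Dw)) (proj₁ Dy′)) λ ()

  -- `x′` lies on an edge that stays untoppled on the y-side, so it belongs to the difference of the
  -- two toppled sets; likewise `y′`.
  no-gate : ∀ {c} X Y → axis X ≡ horizontal → axis Y ≡ vertical → ∀ {x x′ y y′} →
    _∈Edge_ g x X → ¬ Corner g x → _∈Edge_ g x′ (opposite X) →
    _∈Edge_ g y Y → ¬ Corner g y → _∈Edge_ g y′ (opposite Y) →
    Transports g c x x′ (opposite Y) → Transports g c y y′ (opposite X) → ⊥
  no-gate {c} X Y X-hor Y-vert {x} {x′} {y} {y′} x∈X x-inner x′∈X′ y∈Y y-inner y′∈Y′ (x→x′ , x↛Y′) (y→y′ , y↛X′) =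
    ¬¬final (addGrain g x c) λ (t , finalˣ) →
    ¬¬final (addGrain g y c) λ (t′ , finalʸ) →
    separated _ _ (final-excess {c} {x} {y} {t} {t′} finalʸ) (final-excess {c} {y} {x} {t′} {t} finalˣ)
      X Y X-hor Y-vert x∈X x-inner y∈Y y-inner
      (finalˣ x′ x→x′ , untoppled t′ (y↛X′ x′ x′∈X′)) (finalʸ y′ y→y′ , untoppled t (x↛Y′ y′ y′∈Y′))
      x′∈X′ y′∈Y′
    where
    untoppled : ∀ {c u} t → ¬ Topples g c u → toppled (run g c t) u ≡ false
    untoppled t ¬top = ¬-not λ eq → ¬top (Toppled⇒Topples t eq)

  no-crossing : ¬ AdmitsCrossingGate g
  no-crossing (c , _ , X , Y , X≢Y , x , x′ , y , y′ , (x∈X , x-inner) , x′∈X′ , (y∈Y , y-inner) , y′∈Y′ , tˣ , tʸ)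
    with axis X in X-axis | axis Y in Y-axis
  ... | horizontal | vertical   = no-gate X Y X-axis Y-axis x∈X x-inner x′∈X′ y∈Y y-inner y′∈Y′ tˣ tʸ
  ... | vertical   | horizontal = no-gate Y X Y-axis X-axis y∈Y y-inner y′∈Y′ x∈X x-inner x′∈X′ tʸ tˣ
  ... | horizontal | horizontal = X≢Y refl
  ... | vertical   | vertical   = X≢Y refl

-- Multiplicities under permutation.

mult-≈ : ∀ M N → M ≈ N → ∀ δ → mult M δ ≡ mult N δ
mult-≈ M N M≈N δ = ↭-length (filter-↭ (_≟² δ) M≈N)

mult>0⇒∈ : ∀ N {δ} → 0 < mult N δ → δ ∈ elements N
mult>0⇒∈ N {δ} 0<mult with filter (_≟² δ) (elements N) in eq
... | x ∷ xs with x∈N , refl ← ∈-filter⁻ (_≟² δ) {xs = elements N} (subst (x ∈_) (sym eq) (here refl)) = x∈N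

-- Verifying a crossing on a 3 by 3 grid by computation.

module Gate3×3 (nbhd : Cell 3 3 → Neighborhood) (c : Cell 3 3 → ℕ) where

  grid : Grid
  grid = record { ℓ = 3 ; ℓ′ = 3 ; ℓ≥1 = s≤s z≤n ; ℓ′≥1 = s≤s z≤n ; nbhd = nbhd }

  open Dynamics grid

  all-cells? : ∀ {P : Cell 3 3 → Set} → Decidable P → Dec (∀ i j → P (i , j))
  all-cells? P? = all? λ i → all? λ j → P? (i , j)

  stable? : Dec (∀ i j → c (i , j) < size (nbhd (i , j)))
  stable? = all-cells? λ u → c u <? size (nbhd u)

  Closed′ : Configuration grid → (Cell 3 3 → Bool) → Set
  Closed′ d S = ∀ i j → S (i , j) ≡ false → d (i , j) + received S (i , j) < size (nbhd (i , j))

  closed? : ∀ d S → Dec (Closed′ d S)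
  closed? d S = all-cells? λ u → (S u Bool.≟ false) →-dec (d u + received S u <? size (nbhd u))

  x x′ y y′ : Cell 3 3
  x  = zero , suc zero
  x′ = suc (suc zero) , suc zero
  y  = suc zero , zero
  y′ = suc zero , suc (suc zero)

  middle-row : Cell 3 3 → Bool
  middle-row (_ , suc zero) = true
  middle-row _              = false

  -- The centre is missing because `y` topples `y′` by a jump over it.
  column-ends : Cell 3 3 → Bool
  column-ends (suc zero , suc zero) = false
  column-ends (suc zero , _)        = true
  column-ends _                     = false

  -- Along the row, `x`, the centre and `x′` fire at times 0, 1 and 2; along the column, `y` and
  -- `y′` fire at times 0 and 1. The closed sets confine both avalanches.
  crosses : True stable? →
            T (fires grid (run grid (addGrain grid x c) 2) x′) → True (closed? (addGrain grid x c) middle-row) →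
            T (fires grid (run grid (addGrain grid y c) 1) y′) → True (closed? (addGrain grid y c) column-ends) →
            AdmitsCrossingGate grid
  crosses stable x→x′ x-closed y→y′ y-closed =
    c , (λ (i , j) → toWitness stable i j) , west , south , (λ ()) , x , x′ , y , y′ ,
    (refl , x-inner) , refl , (refl , y-inner) , refl ,
    ((2 , x→x′) , x↛north) , ((1 , y→y′) , y↛east)
    where
    x-inner : ¬ Corner grid x
    x-inner (west , west , distinct , _) = distinct refl
    x-inner (west , north , _ , _ , ())
    x-inner (west , south , _ , _ , ())
    x-inner (west , east , _ , _ , ())
    y-inner : ¬ Corner grid y
    y-inner (south , south , distinct , _) = distinct refl
    y-inner (south , north , _ , _ , ())
    y-inner (south , west , _ , _ , ())
    y-inner (south , east , _ , _ , ())

    confined : ∀ d S → True (closed? d S) → ∀ v → Topples grid d v → S v ≡ true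
    confined d S closed v top =
      let t , eq = Topples⇒Toppled top in toppled⊆closed (λ (i , j) → toWitness closed i j) t v eq

    x↛north : ∀ v → _∈Edge_ grid v north → ¬ Topples grid (addGrain grid x c) v
    x↛north v@(_ , suc (suc zero)) _ top = contradiction (confined _ _ x-closed v top) λ ()
    y↛east : ∀ v → _∈Edge_ grid v east → ¬ Topples grid (addGrain grid y c) v
    y↛east v@(suc (suc zero) , _) _ top = contradiction (confined _ _ y-closed v top) λ ()

neighborhood : (δ : ℤ²) (δs : List ℤ²) → All (_≢ (0ℤ , 0ℤ)) (δ ∷ δs) → Neighborhood
neighborhood δ δs nz = record { elements = δ ∷ δs ; nonempty = λ () ; nonzero = nz }

-- Neighborhoods for (a).

module CrossingOnlyNonUniformly where

  A B : Neighborhood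
  A = neighborhood eastward (northward ∷ []) ((λ ()) ∷ (λ ()) ∷ [])
  B = neighborhood northward² (northward² ∷ []) ((λ ()) ∷ (λ ()) ∷ [])

  gate-nbhd : Cell 3 3 → Neighborhood
  gate-nbhd (suc zero , suc zero) = A
  gate-nbhd (suc zero , _)        = B
  gate-nbhd _                     = A

  -- All thresholds are 2. The empty `y′` topples from the two grains that jump from `y`, but not
  -- from the single grain that the centre sends north.
  grains₀ : Cell 3 3 → ℕ
  grains₀ (_ , suc zero)    = 1
  grains₀ (suc zero , zero) = 1
  grains₀ _                 = 0

  open Gate3×3 gate-nbhd grains₀ using (grid; crosses)

  non-uniform : NonUniform A B grid
  non-uniform (zero , _)               = inj₁ ↭-refl
  non-uniform (suc zero , zero)        = inj₂ ↭-refl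
  non-uniform (suc zero , suc zero)    = inj₁ ↭-refl
  non-uniform (suc zero , suc (suc _)) = inj₂ ↭-refl
  non-uniform (suc (suc _) , _)        = inj₁ ↭-refl

  admits : AdmitsCrossingGate grid
  admits = crosses tt tt tt tt tt

  -- Each cell sends `p` grains east and `p` grains north, so `K` is `p`.
  uniform-none : ∀ p q .{{_ : NonZero p}} .{{_ : NonZero q}} g → Uniform (A ^ p ∙ B ^ q) g → ¬ AdmitsCrossingGate g
  uniform-none p q g uniform = NoCrossing.no-crossing g (p * 1 + q * 0) arcs
    (λ u → ≤-reflexive (mult-nbhd u eastward)) (λ u _ → ≤-reflexive (sym (mult-nbhd u northward)))
    where
    open Grid g using (nbhd)
    mult-nbhd : ∀ u δ → mult (nbhd u) δ ≡ p * mult A δ + q * mult B δ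
    mult-nbhd u δ = trans (mult-≈ (nbhd u) (A ^ p ∙ B ^ q) (uniform u) δ) (mult-^ A p B q δ)

    in-A∪B : ∀ {δ} → δ ∈ elements A ⊎ δ ∈ elements B → δ ≡ eastward ⊎ δ ≡ northward ⊎ δ ≡ northward²
    in-A∪B (inj₁ (here eq))         = inj₁ eq
    in-A∪B (inj₁ (there (here eq))) = inj₂ (inj₁ eq)
    in-A∪B (inj₂ (here eq))         = inj₂ (inj₂ eq)
    in-A∪B (inj₂ (there (here eq))) = inj₂ (inj₂ eq)

    positive : ∀ m n → 0 < p * m + q * n → 0 < m ⊎ 0 < n
    positive (suc _) _       _  = inj₁ (s≤s z≤n)
    positive zero    (suc _) _  = inj₂ (s≤s z≤n)
    positive zero    zero    lt = contradiction (sym (cong₂ _+_ (*-zeroʳ p) (*-zeroʳ q))) (<⇒≢ lt)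

    arcs : ∀ u {δ} → 0 < mult (nbhd u) δ → δ ≡ eastward ⊎ δ ≡ northward ⊎ δ ≡ northward²
    arcs u {δ} lt = in-A∪B (Sum.map (mult>0⇒∈ A) (mult>0⇒∈ B)
      (positive (mult A δ) (mult B δ) (subst (0 <_) (mult-nbhd u δ) lt)))

-- Neighborhoods for (b).

module CrossingOnlyUniformly where

  A B : Neighborhood
  A = neighborhood eastward (northward ∷ northward² ∷ northward² ∷ []) ((λ ()) ∷ (λ ()) ∷ (λ ()) ∷ (λ ()) ∷ [])
  B = neighborhood eastward [] ((λ ()) ∷ [])

  -- The union sends 2 grains east, 1 north and 2 by a jump, with threshold 5. The centre, `x′` and
  -- `y′` are two grains short: an arc to the east or a jump topples them, a single northward grain
  -- does not.
  grains₀ : Cell 3 3 → ℕ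
  grains₀ (zero , suc zero)  = 4
  grains₀ (suc zero , zero)  = 4
  grains₀ (_ , suc zero)     = 3
  grains₀ (suc zero , _)     = 3
  grains₀ _                  = 0

  open Gate3×3 (λ _ → A ^ 1 ∙ B ^ 1) grains₀ using (grid; crosses)

  admits : AdmitsCrossingGate grid
  admits = crosses tt tt tt tt tt

  -- Here `K` is 1: cells with `A` send one grain east and one north, and cells with `B` send one
  -- grain east and never jump.
  non-uniform-none : ∀ g → NonUniform A B g → ¬ AdmitsCrossingGate g
  non-uniform-none g choice = NoCrossing.no-crossing g 1 arcs east≤1 1≤north
    where
    open Grid g using (nbhd)

    arcs : ∀ u {δ} → 0 < mult (nbhd u) δ → δ ≡ eastward ⊎ δ ≡ northward ⊎ δ ≡ northward²
    arcs u {δ} lt with choice u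
    ... | inj₁ ≈A with mult>0⇒∈ A (subst (0 <_) (mult-≈ (nbhd u) A ≈A δ) lt)
    ...   | here eq                         = inj₁ eq
    ...   | there (here eq)                 = inj₂ (inj₁ eq)
    ...   | there (there (here eq))         = inj₂ (inj₂ eq)
    ...   | there (there (there (here eq))) = inj₂ (inj₂ eq)
    arcs u {δ} lt | inj₂ ≈B with mult>0⇒∈ B (subst (0 <_) (mult-≈ (nbhd u) B ≈B δ) lt)
    ...   | here eq = inj₁ eq

    east≤1 : ∀ u → mult (nbhd u) eastward ≤ 1
    east≤1 u with choice u
    ... | inj₁ ≈A = ≤-reflexive (mult-≈ (nbhd u) A ≈A eastward)
    ... | inj₂ ≈B = ≤-reflexive (mult-≈ (nbhd u) B ≈B eastward)

    1≤north : ∀ u → 0 < mult (nbhd u) northward² → 1 ≤ mult (nbhd u) northward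
    1≤north u lt with choice u
    ... | inj₁ ≈A = ≤-reflexive (sym (mult-≈ (nbhd u) A ≈A northward))
    ... | inj₂ ≈B = contradiction (subst (0 <_) (mult-≈ (nbhd u) B ≈B northward²) lt) λ ()

mainTheorem3 : (∃[ A ] ∃[ B ]
    (∃[ g ] NonUniform A B g × AdmitsCrossingGate g) ×
    (∀ (p q : ℕ) .{{_ : NonZero p}} .{{_ : NonZero q}} (g : Grid) →
    Uniform (A ^ p ∙ B ^ q) g → ¬ AdmitsCrossingGate g))
    ×
    (∃[ A ] ∃[ B ]
    (∃[ g ] Uniform (A ^ 1 ∙ B ^ 1) g × AdmitsCrossingGate g) ×
    (∀ (g : Grid) → NonUniform A B g → ¬ AdmitsCrossingGate g))
mainTheorem3 =
  (NU.A , NU.B , (_ , NU.non-uniform , NU.admits) , λ p q → NU.uniform-none p q) ,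
  (U.A , U.B , (_ , (λ _ → ↭-refl) , U.admits) , U.non-uniform-none)
  where
  module NU = CrossingOnlyNonUniformly
  module U  = CrossingOnlyUniformly
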